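{- A connected temporal graph $\mathcal{G}=(G,\lambda)$, with $G=(V,E)$, admits a temporal transitive orientation if and only if it belongs to the class $\mathcal{C}_{TTO}$, i.e. if and only if there is a linear ordering $\prec$ of $V$ such that there is no triple $x\prec y\prec z$ with $xy\in E$, $yz\in E$, $\lambda(xy)\le\lambda(yz)$, and ($xz\notin E$ or $\lambda(xz)<\lambda(yz)$).
   Context: A (simple) temporal graph $\mathcal{G}=(G,\lambda)$ consists of a finite simple undirected graph $G=(V,E)$ and a function $\lambda:E\to\mathbb{N}$ (time-labels). It is connected if $G$ is connected. An orientation $O$ of $\mathcal{G}$ is the choice of exactly one of $(a,b)$, $(b,a)$ for each edge $ab\in E$. An orientation $O$ is a temporal transitive orientation (TTO) if whenever $(a,b)\in O$ and $(b,c)\in O$ with $\lambda(ab)\le\lambda(bc)$, then $(a,c)\in O$ and $\lambda(ac)\ge\lambda(bc)$. The class $\mathcal{C}_{TTO}$ is the set of connected temporal graphs admitting a linear ordering of their vertices which avoids the temporal ordered pattern "TTO": three ordered vertices $x\prec y\prec z$, with an edge $xy$ of label $t_1$, an edge $yz$ of label $t_2$, and between $x$ and $z$ either no edge or an edge of label $t_3$, where $t_1\le t_2$ and $t_3<t_2$. -}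

module Defs where

open import Data.Fin.Base using (Fin)
open import Data.Nat.Base using (ℕ; _≤_; _<_; _≥_)
open import Data.Product.Base using (∃; Σ-syntax; _×_)
open import Data.Sum.Base using (_⊎_)
open import Level using (0ℓ)
open import Relation.Binary.Construct.Closure.ReflexiveTransitive using (Star)
open import Relation.Binary.Core using (Rel)
open import Relation.Binary.Definitions using (Decidable; Irreflexive; Symmetric)
open import Relation.Binary.PropositionalEquality.Core using (_≡_)
open import Relation.Binary.Structures using (IsStrictTotalOrder)
open import Relation.Nullary.Negation.Core using (¬_)

record Graph : Set₁ where
  infix 4 _—_
  field
    order    : ℕ

  V : Set
  V = Fin order

  field
    _—_      : Rel V 0ℓ
    —-sym    : Symmetric _—_
    —-irrefl : Irreflexive _≡_ _—_
    _—?_     : Decidable _—_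

Connected : Graph → Set
Connected G = ∀ u v → Star _—_ u v
  where open Graph G

record TemporalGraph : Set₁ where
  field
    graph : Graph

  open Graph graph public

  field
    label     : ∀ {u v} → u — v → ℕ
    -- Quantifying over both e and e′ makes the label a function of the
    -- unordered pair uv: applied twice, it also gives that the label does
    -- not depend on the proof of adjacency.
    label-sym : ∀ {u v} (e : u — v) (e′ : v — u) → label e ≡ label e′

record Orientation (G : Graph) : Set₁ where
  open Graph G
  infix 4 _⇒_
  field
    _⇒_         : Rel V 0ℓ
    ⇒-edge      : ∀ {a b} → a ⇒ b → a — b
    exactly-one : ∀ {a b} → a — b →
                  (a ⇒ b × ¬ (b ⇒ a)) ⊎ (¬ (a ⇒ b) × b ⇒ a)

module _ (𝒢 : TemporalGraph) where
  open TemporalGraph 𝒢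

  IsTTO : Orientation graph → Set
  IsTTO O = ∀ {a b c} (ab : a ⇒ b) (bc : b ⇒ c) →
            label (⇒-edge ab) ≤ label (⇒-edge bc) →
            Σ[ ac ∈ a ⇒ c ] label (⇒-edge ac) ≥ label (⇒-edge bc)
    where open Orientation O

  AdmitsTTO : Set₁
  AdmitsTTO = ∃ IsTTO

  record PatternTTO (_≺_ : Rel V 0ℓ) : Set where
    field
      {x y z} : V
      x≺y     : x ≺ y
      y≺z     : y ≺ z
      xy      : x — y
      yz      : y — z
      t₁≤t₂   : label xy ≤ label yz
      xz      : ¬ (x — z) ⊎ (Σ[ e ∈ x — z ] label e < label yz)

  record _∈𝒞-TTO : Set₁ where
    field
      connected          : Connected graph
      _≺_                : Rel V 0ℓ
      isStrictTotalOrder : IsStrictTotalOrder _≡_ _≺_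
      avoids             : ¬ PatternTTO _≺_

{-# OPTIONS --safe #-}

-- A temporal transitive orientation has no directed cycle: in a closed directed
-- walk choose an edge y ⇒ z of maximal label t.  Going backwards along the rest
-- of the walk from z to y, the property "a ⇒ z with label at least t" propagates
-- from each vertex to its predecessor, because all the labels met are at most t;
-- hence z ⇒ z, which is absurd.  So the orientation extends to a linear order, and in
-- such an order an occurrence of the pattern would violate the orientation axiom.
-- Conversely, an order avoiding the pattern orients every edge upwards.
module Submission where

open import Defs
open import Data.Empty using (⊥)
open import Data.Fin.Base as Fin using (Fin)
open import Data.Fin.Induction using (spo-wellFounded)
import Data.Fin.Properties as Fin
open import Data.List.Base using (tabulate)
open import Data.List.Extrema.Nat using (max; xs≤max)
open import Data.List.Properties using (tabulate-cong)
import Data.List.Relation.Unary.All.Properties as All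
open import Data.Nat.Base as ℕ using (ℕ; suc; _≤_)
import Data.Nat.Properties as ℕ
open import Data.Product.Base using (∃; ∃₂; Σ-syntax; _×_; _,_; proj₁; proj₂; <_,_>)
open import Data.Product.Relation.Binary.Lex.Strict using (×-Lex; ×-compare; ×-transitive)
open import Data.Sum.Base using (_⊎_; inj₁; inj₂)
open import Function.Base using (id; _on_)
open import Function.Bundles using (_⇔_; mk⇔)
open import Induction.WellFounded using (WellFounded; WfRec; module All; module FixPoint)
open import Level using (0ℓ)
open import Relation.Binary.Construct.Closure.ReflexiveTransitive as Star
  using (Star; ε; _◅_; _◅◅_)
open import Relation.Binary.Construct.Closure.Transitive as Plus
  using (TransClosure; [_]; _∷_)
open import Relation.Binary.Core using (Rel)
open import Relation.Binary.Definitions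
  using (Decidable; Transitive; Trichotomous; tri<; tri≈; tri>)
open import Relation.Binary.PropositionalEquality
  using (_≡_; refl; sym; trans; cong; isEquivalence; resp₂)
open import Relation.Binary.Structures using (IsStrictPartialOrder; IsStrictTotalOrder)
open import Relation.Binary.Structures.Biased using (isStrictTotalOrderᶜ)
open import Relation.Nullary.Decidable.Core using (Dec; yes; no)
open import Relation.Nullary.Negation.Core using (¬_; contradiction)

Acyclic : ∀ {n} → Rel (Fin n) 0ℓ → Set
Acyclic _⇒_ = ∀ {x} → ¬ TransClosure _⇒_ x x

-- Acyclicity makes the transitive closure a strict partial order, which is well-founded on a finite
-- set; a relation inherits this from its closure.
acyclic⇒wellFounded : ∀ {n} {_⇒_ : Rel (Fin n) 0ℓ} → Acyclic _⇒_ → WellFounded _⇒_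
acyclic⇒wellFounded {_⇒_ = _⇒_} acyclic = Plus.wellFounded⁻ _⇒_ (spo-wellFounded spo)
  where
  spo : IsStrictPartialOrder _≡_ (TransClosure _⇒_)
  spo = record
    { isEquivalence = isEquivalence
    ; irrefl        = λ { refl → acyclic }
    ; trans         = Plus._++_
    ; <-resp-≈      = resp₂ _
    }

module Height {n} {_⇒_ : Rel (Fin n) 0ℓ}
              (wf : WellFounded _⇒_) (_⇒?_ : Decidable _⇒_) where

  -- Well-founded recursion gives a value at `u` only from a proof of `u ⇒ v`, hence `h` depends on
  -- that proof. The default 0 is neutral for the maximum in `step`.
  heightVia : ∀ {u v} → Dec (u ⇒ v) → (u ⇒ v → ℕ) → ℕ
  heightVia (yes e) h = suc (h e)
  heightVia (no _)  h = 0

  heightVia-cong : ∀ {u v} (d : Dec (u ⇒ v)) {h h′ : u ⇒ v → ℕ} →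
                   (∀ e → h e ≡ h′ e) → heightVia d h ≡ heightVia d h′
  heightVia-cong (yes e) eq = cong suc (eq e)
  heightVia-cong (no _)  eq = refl

  <heightVia : ∀ {u v} (d : Dec (u ⇒ v)) {k} → u ⇒ v → k ℕ.< heightVia d (λ _ → k)
  <heightVia (yes _) _ = ℕ.n<1+n _
  <heightVia (no ¬e) e = contradiction e ¬e

  step : ∀ v → WfRec _⇒_ (λ _ → ℕ) v → ℕ
  step v h = max 0 (tabulate λ u → heightVia (u ⇒? v) h)

  -- This extensionality is what `unfold-wfRec` asks for before it unfolds `height`.
  step-cong : ∀ v {h h′ : WfRec _⇒_ (λ _ → ℕ) v} →
              (∀ {u} (e : u ⇒ v) → h e ≡ h′ e) → step v h ≡ step v h′
  step-cong v eq = cong (max 0) (tabulate-cong λ u → heightVia-cong (u ⇒? v) eq)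

  -- The length of a longest directed path ending at the given vertex.
  height : Fin n → ℕ
  height = All.wfRec wf 0ℓ (λ _ → ℕ) step

  height-mono : ∀ {u v} → u ⇒ v → height u ℕ.< height v
  height-mono {u} {v} e = begin-strict
    height u                               <⟨ <heightVia (u ⇒? v) e ⟩
    heightVia (u ⇒? v) (λ _ → height u)    ≤⟨ All.tabulate⁻ (xs≤max 0 _) u ⟩
    step v (λ {w} _ → height w)            ≡⟨ unfold-wfRec ⟨
    height v                               ∎
    where
    open ℕ.≤-Reasoning
    open FixPoint wf (λ _ → ℕ) step step-cong using (unfold-wfRec)

-- Ties of f are broken by the order of Fin n.
module RankOrder {n} (f : Fin n → ℕ) where

  infix 4 _≺_
  _≺_ : Rel (Fin n) 0ℓ
  _≺_ = ×-Lex _≡_ ℕ._<_ Fin._<_ on < f , id >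

  ≺-trans : Transitive _≺_
  ≺-trans = ×-transitive {_<₂_ = Fin._<_} isEquivalence (resp₂ ℕ._<_) ℕ.<-trans Fin.<-trans

  ≺-compare : Trichotomous _≡_ _≺_
  ≺-compare u v
    with ×-compare {_<₁_ = ℕ._<_} {_<₂_ = Fin._<_} sym ℕ.<-cmp Fin.<-cmp (f u , u) (f v , v)
  ... | tri< u≺v u≉v v⊀u = tri< u≺v (λ { refl → u≉v (refl , refl) }) v⊀u
  ... | tri≈ u⊀v u≈v v⊀u = tri≈ u⊀v (proj₂ u≈v) v⊀u
  ... | tri> u⊀v u≉v v≺u = tri> u⊀v (λ { refl → u≉v (refl , refl) }) v≺u

  ≺-isStrictTotalOrder : IsStrictTotalOrder _≡_ _≺_
  ≺-isStrictTotalOrder = isStrictTotalOrderᶜ record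
    { isEquivalence = isEquivalence
    ; trans         = ≺-trans
    ; compare       = ≺-compare
    }

-- Arrows strictly raise `height`, so they already ascend in the first lexicographic coordinate,
-- where no tie arises.
linearExtension : ∀ {n} {_⇒_ : Rel (Fin n) 0ℓ} → Decidable _⇒_ → Acyclic _⇒_ →
                  ∃ λ (_≺_ : Rel (Fin n) 0ℓ) →
                    IsStrictTotalOrder _≡_ _≺_ × (∀ {u v} → u ⇒ v → u ≺ v)
linearExtension _⇒?_ acyclic =
  _≺_ , ≺-isStrictTotalOrder , λ e → inj₁ (height-mono e)
  where
  open Height (acyclic⇒wellFounded acyclic) _⇒?_
  open RankOrder height

module _ (𝒢 : TemporalGraph) where
  open TemporalGraph 𝒢

  -- Bridges the adjacency proof contained in an arrow and the one supplied by a pattern.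
  label-irrelevant : ∀ {u v} (e e′ : u — v) → label e ≡ label e′
  label-irrelevant e e′ = trans (label-sym e (—-sym e)) (sym (label-sym e′ (—-sym e)))

  module _ (O : Orientation graph) where
    open Orientation O

    ⇒-irrefl : ∀ {u} → ¬ (u ⇒ u)
    ⇒-irrefl e = —-irrefl refl (⇒-edge e)

    -- An orientation is an arbitrary relation, but adjacency is decidable and `exactly-one` reveals
    -- the direction of each edge. The computation of `height` relies on this.
    _⇒?_ : Decidable _⇒_
    u ⇒? v with u —? v
    ... | no ¬uv = no λ e → ¬uv (⇒-edge e)
    ... | yes uv with exactly-one uv
    ...   | inj₁ (u⇒v , _) = yes u⇒v
    ...   | inj₂ (u⇏v , _) = no u⇏v

    ℓ : ∀ {u v} → u ⇒ v → ℕ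
    ℓ e = label (⇒-edge e)

    _⇒[≤_]_ : V → ℕ → V → Set
    u ⇒[≤ t ] v = Σ[ e ∈ u ⇒ v ] ℓ e ≤ t

    WalkBelow : ℕ → Rel V 0ℓ
    WalkBelow t = Star (_⇒[≤ t ]_)

    weaken : ∀ {s t u v} → s ≤ t → WalkBelow s u v → WalkBelow t u v
    weaken s≤t = Star.map λ (e , e≤s) → e , ℕ.≤-trans e≤s s≤t

    -- Induction on the walk: its first edge is compared with a heaviest edge of the remainder.
    splitAtMax : ∀ {u v} → TransClosure _⇒_ u v →
                 ∃₂ λ y z → Σ[ e ∈ y ⇒ z ] WalkBelow (ℓ e) u y × WalkBelow (ℓ e) z v
    splitAtMax [ e ] = _ , _ , e , ε , ε
    splitAtMax (d ∷ p) with splitAtMax p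
    ... | y , z , e , before , after with ℕ.≤-total (ℓ d) (ℓ e)
    ...   | inj₁ d≤e = y , z , e , (d , d≤e) ◅ before , after
    -- The first edge is now the heaviest, so the old pieces are rejoined around `e` into the walk
    -- that follows it.
    ...   | inj₂ e≤d = _ , _ , d , ε ,
      weaken e≤d before ◅◅ (e , e≤d) ◅ weaken e≤d after

    -- The edges derived into `z` may get heavier, so the induction keeps only the lower bound `t`.
    -- Walk labels stay at most `t`, so the orientation axiom applies at each step back.
    absorb : IsTTO 𝒢 O → ∀ {t a y z} → WalkBelow t a y →
             (e : y ⇒ z) → t ≤ ℓ e → Σ[ e′ ∈ a ⇒ z ] t ≤ ℓ e′
    absorb tto ε e t≤e = e , t≤e
    absorb tto ((d , d≤t) ◅ p) e t≤e =
      let e′ , t≤e′  = absorb tto p e t≤e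
          e″ , e′≤e″ = tto d e′ (ℕ.≤-trans d≤t t≤e′)
      in e″ , ℕ.≤-trans t≤e′ e′≤e″

    tto⇒acyclic : IsTTO 𝒢 O → Acyclic _⇒_
    tto⇒acyclic tto p =
      let _ , _ , e , before , after = splitAtMax p
      -- Cutting the closed walk at `e` leaves a walk from the head of `e` round to its tail, so the
      -- absorbed arrow is a loop.
      in ⇒-irrefl (proj₁ (absorb tto (after ◅◅ before) e ℕ.≤-refl))

    module _ {_≺_ : Rel V 0ℓ} (≺-sto : IsStrictTotalOrder _≡_ _≺_)
             (⇒⊆≺ : ∀ {u v} → u ⇒ v → u ≺ v) where
      open IsStrictTotalOrder ≺-sto using (asym)

      orient : ∀ {u v} → u — v → u ≺ v → u ⇒ v
      orient uv u≺v with exactly-one uv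
      ... | inj₁ (u⇒v , _) = u⇒v
      ... | inj₂ (_ , v⇒u) = contradiction (⇒⊆≺ v⇒u) (asym u≺v)

      tto⇒avoids : IsTTO 𝒢 O → ¬ PatternTTO 𝒢 _≺_
      tto⇒avoids tto P = violates xz
        where
        open PatternTTO P

        x⇒y = orient xy x≺y
        y⇒z = orient yz y≺z

        xy≡ = label-irrelevant (⇒-edge x⇒y) xy
        yz≡ = label-irrelevant (⇒-edge y⇒z) yz

        transitive = tto x⇒y y⇒z
          (ℕ.≤-trans (ℕ.≤-reflexive xy≡) (ℕ.≤-trans t₁≤t₂ (ℕ.≤-reflexive (sym yz≡))))

        violates : ¬ (x — z) ⊎ (Σ[ e ∈ x — z ] label e ℕ.< label yz) → ⊥
        violates (inj₁ ¬xz) = ¬xz (⇒-edge (proj₁ transitive))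
        violates (inj₂ (e , e<yz)) = ℕ.<⇒≱ e<yz (begin
          label yz              ≡⟨ yz≡ ⟨
          ℓ y⇒z                 ≤⟨ proj₂ transitive ⟩
          ℓ (proj₁ transitive)  ≡⟨ label-irrelevant _ e ⟩
          label e               ∎)
          where open ℕ.≤-Reasoning

  module _ {_≺_ : Rel V 0ℓ} (≺-sto : IsStrictTotalOrder _≡_ _≺_) where
    open IsStrictTotalOrder ≺-sto using (compare) renaming (trans to ≺-trans)

    upward : Orientation graph
    upward = record
      { _⇒_         = λ u v → u — v × u ≺ v
      ; ⇒-edge      = proj₁
      ; exactly-one = exactly-one
      }
      where
      exactly-one : ∀ {a b} → a — b → _
      exactly-one {a} {b} ab with compare a b
      ... | tri< a≺b _ b⊀a = inj₁ ((ab , a≺b) , λ (_ , b≺a) → b⊀a b≺a)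
      ... | tri≈ _ a≡b _   = contradiction ab (—-irrefl a≡b)
      ... | tri> a⊀b _ b≺a = inj₂ ((λ (_ , a≺b) → a⊀b a≺b) , (—-sym ab , b≺a))

    -- A failure of the axiom for upward arrows is an occurrence of the pattern. Deciding adjacency
    -- of `a` and `c`, and the order of labels, turns this into a positive conclusion.
    avoids⇒tto : ¬ PatternTTO 𝒢 _≺_ → IsTTO 𝒢 upward
    avoids⇒tto avoids {a} {b} {c} (ab , a≺b) (bc , b≺c) ab≤bc with a —? c
    ... | no ¬ac = contradiction
      record { x≺y = a≺b ; y≺z = b≺c ; xy = ab ; yz = bc ; t₁≤t₂ = ab≤bc ; xz = inj₁ ¬ac }
      avoids
    ... | yes ac = (ac , ≺-trans a≺b b≺c) , ℕ.≮⇒≥ λ ac<bc → avoids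
      record { x≺y = a≺b ; y≺z = b≺c ; xy = ab ; yz = bc ; t₁≤t₂ = ab≤bc
             ; xz = inj₂ (ac , ac<bc) }

theorem5 : (𝒢 : TemporalGraph) → Connected (TemporalGraph.graph 𝒢) →
    AdmitsTTO 𝒢 ⇔ 𝒢 ∈𝒞-TTO
theorem5 𝒢 connected = mk⇔ to from
  where
  to : AdmitsTTO 𝒢 → 𝒢 ∈𝒞-TTO
  to (O , tto) =
    let _≺_ , ≺-sto , ⇒⊆≺ = linearExtension (_⇒?_ 𝒢 O) (tto⇒acyclic 𝒢 O tto)
    in record
      { connected          = connected
      ; _≺_                = _≺_
      ; isStrictTotalOrder = ≺-sto
      ; avoids             = tto⇒avoids 𝒢 O ≺-sto ⇒⊆≺ tto
      }

  from : 𝒢 ∈𝒞-TTO → AdmitsTTO 𝒢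
  from C = upward 𝒢 isStrictTotalOrder , avoids⇒tto 𝒢 isStrictTotalOrder avoids
    where open _∈𝒞-TTO C
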